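{- Let $n,s,h,k \in \mathbb{Z}^+$ with $1 \leq s \leq n-2$, $k \leq \binom{n}{2}$, and $0 \leq h < n$. If $\gcd(s,n) = 1$, then there is an $s$-overlap cycle for $\mathcal{W}_k(n,h)$.
   Context: $\mathcal{W}(n)$ denotes the set of weak orders on $[n]$ (transitive and complete relations), represented as words: $\mathcal{W}(n)$ is the set of all words $w_1w_2\ldots w_n$ of length $n$ over the nonnegative integers such that $\{w_1,\dots,w_n\} = \{0,1,\dots,h\}$ for some $h$ with $0 \le h \le n-1$ (here $w_j$ is the height of element $j$ in the weak order). This $h$, i.e. the maximum letter of $w$, is the height of $w$; the weight of $w$ is $\sum_{i=1}^n w_i$. $\mathcal{W}_k(n,h)$ is the set of $w \in \mathcal{W}(n)$ of height $h$ and weight $k$. An $s$-overlap cycle ($s$-ocycle) for a set of words of length $n$ is a cyclically ordered listing of the words in the set, each appearing exactly once, such that the last $s$ letters of each word are the first $s$ letters (in the same order) of its successor in the listing (the successor of the last word being the first word). If the set is empty, the empty listing is an $s$-ocycle for it. -}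

module Defs where

open import Level using (Level; _⊔_)
open import Data.Nat.Base as ℕ using (ℕ; _≤_; _<_)
open import Data.List.Base using (List; []; _∷_; _∷ʳ_; _++_; length)
open import Data.List.Membership.Propositional as List using ()
open import Data.List.Relation.Unary.Linked using (Linked)
open import Data.List.Relation.Unary.Unique.Propositional using (Unique)
open import Data.Product.Base using (∃; ∃-syntax; _×_)
open import Data.Unit.Polymorphic.Base using (⊤)
open import Data.Vec.Base using (Vec; toList; foldr′; sum)
open import Data.Vec.Membership.Propositional as Vec using ()
open import Function.Bundles using (_⇔_)
open import Relation.Binary.Core using (Rel)
open import Relation.Binary.PropositionalEquality.Core using (_≡_)
open import Relation.Unary using (Pred)

private
  variable
    a ℓ : Level
    A : Set a
    n : ℕ

-- The j-th letter of a word is the height of element j in the weak order; the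
-- letters used are exactly 0, 1, …, h for some h ≤ n - 1.
IsWeakOrder : Pred (Vec ℕ n) _
IsWeakOrder {n} w = ∃[ h ] (h < n × (∀ x → (x Vec.∈ w) ⇔ (x ≤ h)))

-- The maximum letter (with value 0 on the empty word, which is not a weak order
-- in the sense above).
height : Vec ℕ n → ℕ
height = foldr′ ℕ._⊔_ 0

weight : Vec ℕ n → ℕ
weight = sum

𝒲 : (k n h : ℕ) → Pred (Vec ℕ n) _
𝒲 k n h w = IsWeakOrder w × height w ≡ h × weight w ≡ k

-- The last s letters of u are the first s letters of v: u = p m and v = m q
-- with m of length s.
Overlap : ℕ → Rel (Vec A n) _
Overlap s u v =
  ∃[ p ] ∃[ m ] ∃[ q ] (length m ≡ s × toList u ≡ p ++ m × toList v ≡ m ++ q)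

-- R relates each entry to the next one and the last entry to the first; in
-- particular a one-element list requires R x x.
CyclicallyLinked : {A : Set a} → Rel A ℓ → List A → Set (a ⊔ ℓ)
CyclicallyLinked R []       = ⊤
CyclicallyLinked R (x ∷ xs) = Linked R (x ∷ xs ∷ʳ x)

record IsOverlapCycle {A : Set a} {n : ℕ} (s : ℕ) (P : Pred (Vec A n) ℓ)
                      (ws : List (Vec A n)) : Set (a ⊔ ℓ) where
  field
    unique : Unique ws
    lists  : ∀ w → (w List.∈ ws) ⇔ P w
    cyclic : CyclicallyLinked (Overlap s) ws

{-# OPTIONS --safe #-}
module Submission where

-- The rotation ρ by n - s letters maps a word to one overlapping it, so every
-- ρ-orbit is an s-ocycle. If a ρ-stable cycle contains u but not v, and u and v
-- share their first s letters, then the orbit of v can be spliced in next to u.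
-- It remains to join any two words of 𝒲 k n h by rotations and by changes of the
-- last n - s letters. As gcd s n = 1, powers of ρ give all rotations, and as
-- n - s ≥ 2, any two cyclically adjacent letters may be changed. Transpositions
-- give all permutations, so one copy of 0, …, h can be set aside; unit transfers
-- between the remaining letters then equalise them one at a time.

open import Defs
open import Data.List.Base
  using (List; []; _∷_; _++_; _∷ʳ_; [_]; applyUpTo; cartesianProductWith; drop; filter;
         length; map; take; upTo)
open import Data.List.Membership.Propositional using (_∈_; _∉_)
open import Data.List.Membership.Propositional.Properties
  using (∈-++⁺ˡ; ∈-++⁺ʳ; ∈-++⁻; ∈-∃++; ∈-applyUpTo⁺; ∈-applyUpTo⁻; ∈-cartesianProductWith⁺;
         ∈-filter⁺; ∈-filter⁻; ∈-map⁺; ∈-map⁻; ∈-upTo⁺; ∈-upTo⁻)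
import Data.List.Membership.DecPropositional as DecMembership
open import Data.List.Properties
  using (++-assoc; ++-identityʳ; applyUpTo-∷ʳ; length-++; length-drop; length-take; map-++;
         take++drop≡id; ≡-dec)
open import Data.List.Relation.Binary.Permutation.Propositional
  using (_↭_; refl; prep; swap; trans; ↭-refl; ↭-reflexive; ↭-sym; ↭-trans; ↭⇒↭ₛ)
open import Data.List.Relation.Binary.Permutation.Propositional.Properties using (∈-resp-↭)
import Data.List.Relation.Binary.Permutation.Propositional.Properties as ↭
import Data.List.Relation.Binary.Permutation.Setoid.Properties as ↭ₛ
open import Data.List.Relation.Binary.Subset.Propositional using (_⊆_)
open import Data.List.Relation.Unary.All as All using (All; []; _∷_)
import Data.List.Relation.Unary.All.Properties as All
open import Data.List.Relation.Unary.AllPairs using ([]; _∷_)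
open import Data.List.Relation.Unary.Any using (here; there)
open import Data.List.Relation.Unary.Linked using (Linked; [-]; _∷_)
import Data.List.Relation.Unary.Linked.Properties as Linked
open import Data.List.Relation.Unary.Unique.Propositional using (Unique)
import Data.List.Relation.Unary.Unique.Propositional.Properties as Unique
open import Data.Nat.Base using (ℕ; zero; suc; _+_; _*_; _∸_; _≤_; _<_; z≤n; s≤s; s≤s⁻¹)
open import Data.Nat.Combinatorics using (_C_)
open import Data.Nat.GCD using (gcd; gcd-GCD; module GCD; module Bézout)
open import Data.Nat.GeneralisedArithmetic using (fold; fold-+)
open import Data.Nat.ListAction using (sum)
open import Data.Nat.ListAction.Properties using (sum-++; sum-↭)
open import Data.Nat.Properties as ℕ hiding (_≟_)
open import Data.Product.Base using (∃-syntax; _×_; _,_; proj₂)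
open import Data.Sum.Base using (_⊎_; inj₁; inj₂; [_,_]′)
open import Data.Unit.Polymorphic.Base using (tt)
open import Data.Vec.Base using (Vec; []; _∷_; fromList; toList)
open import Data.Vec.Membership.Propositional renaming (_∈_ to _∈ᵛ_) using ()
open import Data.Vec.Membership.Propositional.Properties using (∈-toList⁺; ∈-toList⁻)
open import Data.Vec.Properties
  using (cast-is-id; length-toList; toList-injective; toList∘fromList)
open import Data.Vec.Relation.Unary.Any using (here; there)
open import Function.Base using (_∘_; _on_; case_of_; id)
open import Function.Bundles using (_⇔_; mk⇔; Equivalence)
open import Level using (Level; _⊔_)
open import Relation.Binary.Construct.Closure.Equivalence as EqClosure using (EqClosure)
open import Relation.Binary.Construct.Closure.ReflexiveTransitive using (ε; _◅_; _◅◅_)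
open import Relation.Binary.Construct.Closure.Symmetric using (SymClosure; bwd; fwd)
open import Relation.Binary.Core using (Rel)
open import Relation.Binary.Definitions
  using (DecidableEquality; Symmetric; tri<; tri≈; tri>)
open import Relation.Binary.PropositionalEquality as ≡
  using (_≡_; _≢_; refl; sym; cong; cong₂; subst; subst₂; module ≡-Reasoning)
open import Relation.Nullary using (¬_; yes; no; contradiction)
open import Relation.Nullary.Decidable using (map′; _×-dec_)
open import Relation.Unary using (Pred; Decidable)

private
  variable
    a b e ℓ r : Level
    A B : Set a

-- Iteration and least witnesses.

fold-suc : ∀ (x : A) f i → fold (f x) f i ≡ f (fold x f i)
fold-suc x f zero    = refl
fold-suc x f (suc i) = cong f (fold-suc x f i)

least : ∀ {P : Pred ℕ ℓ} → Decidable P → ∀ n → P n → ∃[ d ] (P d × (∀ {j} → j < d → ¬ P j))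
least P? zero    Pn = zero , Pn , λ ()
least {P = P} P? (suc n) Pn with P? zero
... | yes P0 = zero , P0 , λ ()
... | no ¬P0 with least (P? ∘ suc) n Pn
...   | d , Pd , min = suc d , Pd , min′ _
  where
  min′ : ∀ j → j < suc d → ¬ P j
  min′ zero    _   = ¬P0
  min′ (suc j) j<d = min (s≤s⁻¹ j<d)

-- Cutting, rotating and merging cyclic lists.

module _ {R : Rel A r} where

  Linked-split : ∀ xs {y ys} → Linked R (xs ++ y ∷ ys) →
                 Linked R (xs ++ [ y ]) × Linked R (y ∷ ys)
  Linked-split []           l       = [-] , l
  Linked-split (x ∷ [])     (h ∷ l) = h ∷ [-] , l
  Linked-split (x ∷ z ∷ xs) (h ∷ l) with Linked-split (z ∷ xs) l
  ... | l₁ , l₂ = h ∷ l₁ , l₂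

  Linked-join : ∀ xs {y ys} → Linked R (xs ++ [ y ]) → Linked R (y ∷ ys) →
                Linked R (xs ++ y ∷ ys)
  Linked-join []           _       l = l
  Linked-join (x ∷ [])     (h ∷ _) l = h ∷ l
  Linked-join (x ∷ z ∷ xs) (h ∷ k) l = h ∷ Linked-join (z ∷ xs) k l

  Linked-last : ∀ xs {y z} → (∀ {x} → R x y → R x z) →
                Linked R (xs ++ [ y ]) → Linked R (xs ++ [ z ])
  Linked-last []           f _       = [-]
  Linked-last (x ∷ [])     f (h ∷ l) = f h ∷ [-]
  Linked-last (x ∷ w ∷ xs) f (h ∷ l) = h ∷ Linked-last (w ∷ xs) f l

  -- Cut the closed list at `y` and glue the two pieces the other way round: the first piece ends in
  -- `y`, the second in the old starting point, so they fit in either order.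
  cyclic-rotate : ∀ xs {y ys} → CyclicallyLinked R (xs ++ y ∷ ys) →
                  CyclicallyLinked R (y ∷ ys ++ xs)
  cyclic-rotate [] {y} {ys} l = subst (CyclicallyLinked R) (cong (y ∷_) (sym (++-identityʳ ys))) l
  cyclic-rotate (x ∷ xs) {y} {ys} l
    with Linked-split (x ∷ xs) (subst (Linked R) (++-assoc (x ∷ xs) (y ∷ ys) [ x ]) l)
  ... | l₁ , l₂ = subst (Linked R) (sym (++-assoc (y ∷ ys) (x ∷ xs) [ y ]))
                    (Linked-join (y ∷ ys) l₂ l₁)

  -- Only the two closing links change: the one back to `x` is redirected to `y`, and the one back
  -- to `y` to `x`. This turns two cycles into one.
  cyclic-merge : ∀ {x xs y ys} → (∀ {z} → R z x → R z y) → (∀ {z} → R z y → R z x) →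
                 CyclicallyLinked R (x ∷ xs) → CyclicallyLinked R (y ∷ ys) →
                 CyclicallyLinked R ((x ∷ xs) ++ (y ∷ ys))
  cyclic-merge {x} {xs} {y} {ys} f g l m = subst (Linked R) (sym (++-assoc (x ∷ xs) (y ∷ ys) [ x ]))
    (Linked-join (x ∷ xs) (Linked-last (x ∷ xs) f l) (Linked-last (y ∷ ys) g m))

-- Growing a cycle by splicing in orbits.

module CycleGrowth {A : Set a} (_≟_ : DecidableEquality A)
  (R : Rel A r) (E : Rel A e) (P : Pred A ℓ)
  (E-sym : Symmetric E)
  (R-resp-E : ∀ {x y z} → R x y → E y z → R x z)
  (ρ : A → A) (m : ℕ)
  (ρ-P : ∀ {x} → P x → P (ρ x))
  (ρ-R : ∀ {x} → P x → R x (ρ x))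
  (ρ-period : ∀ {x} → P x → fold x ρ (suc m) ≡ x)
  where

  open DecMembership _≟_ using (_∈?_)

  record Step (x y : A) : Set (a ⊔ e ⊔ ℓ) where
    constructor step
    field
      source : P x
      target : P y
      move   : E x y ⊎ y ≡ ρ x

  record StableCycle (xs : List A) : Set (a ⊔ r ⊔ ℓ) where
    field
      unique : Unique xs
      sound  : ∀ {x} → x ∈ xs → P x
      stable : ∀ {x} → x ∈ xs → ρ x ∈ xs
      cyclic : CyclicallyLinked R xs

    stable-fold : ∀ {x} i → x ∈ xs → fold x ρ i ∈ xs
    stable-fold zero    x∈ = x∈
    stable-fold (suc i) x∈ = stable (stable-fold i x∈)

    -- The period is written `suc m` so that `m` further applications of `ρ` undo one. Forward
    -- stability therefore gives backward stability.
    stable⁻¹ : ∀ {x} → P x → ρ x ∈ xs → x ∈ xs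
    stable⁻¹ {x} Px ρx∈ =
      subst (_∈ xs) (≡.trans (fold-suc x ρ m) (ρ-period Px)) (stable-fold m ρx∈)

  open StableCycle

  fold-P : ∀ {x} i → P x → P (fold x ρ i)
  fold-P zero    Px = Px
  fold-P (suc i) Px = ρ-P (fold-P i Px)

  stable-fold⁻¹ : ∀ {xs} → StableCycle xs → ∀ {x} i → P x → fold x ρ i ∈ xs → x ∈ xs
  stable-fold⁻¹ c zero    Px x∈ = x∈
  stable-fold⁻¹ c (suc i) Px x∈ = stable-fold⁻¹ c i Px (stable⁻¹ c (fold-P i Px) x∈)

  ρ-injective : ∀ {x y} → P x → P y → ρ x ≡ ρ y → x ≡ y
  ρ-injective {x} {y} Px Py eq = begin
    x                ≡⟨ ρ-period Px ⟨
    fold x ρ (suc m) ≡⟨ fold-suc x ρ m ⟨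
    fold (ρ x) ρ m   ≡⟨ cong (λ z → fold z ρ m) eq ⟩
    fold (ρ y) ρ m   ≡⟨ fold-suc y ρ m ⟩
    fold y ρ (suc m) ≡⟨ ρ-period Py ⟩
    y                ∎
    where open ≡-Reasoning

  fold-injective : ∀ {x y} i → P x → P y → fold x ρ i ≡ fold y ρ i → x ≡ y
  fold-injective zero    Px Py eq = eq
  fold-injective (suc i) Px Py eq =
    fold-injective i Px Py (ρ-injective (fold-P i Px) (fold-P i Py) eq)

  -- List the iterates of `x` up to the first return. An earlier repetition would, by injectivity of
  -- `ρ`, yield an earlier return.
  orbit : ∀ {x} → P x →
          ∃[ xs ] (StableCycle (x ∷ xs) × (∀ {y} → y ∈ x ∷ xs → ∃[ i ] y ≡ fold x ρ i))
  orbit {x} Px with least (λ i → fold x ρ (suc i) ≟ x) m (ρ-period Px)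
  ... | d , period , min = applyUpTo (f ∘ suc) d , record
    { unique = Unique.applyUpTo⁺₁ f (suc d) distinct
    ; sound  = λ y∈ → let i , _ , eq = ∈-applyUpTo⁻ f {n = suc d} y∈ in
                      subst P (sym eq) (fold-P i Px)
    ; stable = λ y∈ → let i , i<d , eq = ∈-applyUpTo⁻ f {n = suc d} y∈ in
                      subst (λ z → ρ z ∈ applyUpTo f (suc d)) (sym eq) (next (s≤s⁻¹ i<d))
    -- The closing entry `x` equals `f (suc d)`, so the closed list consists of the first `d + 2`
    -- iterates.
    ; cyclic = subst (Linked R)
        (sym (≡.trans (cong (λ z → f 0 ∷ (applyUpTo (f ∘ suc) d ++ [ z ])) (sym period))
                    (applyUpTo-∷ʳ f (suc d))))
        (Linked.applyUpTo⁺₂ f (suc (suc d)) (λ i → ρ-R (fold-P i Px)))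
    } , λ y∈ → let i , _ , eq = ∈-applyUpTo⁻ f {n = suc d} y∈ in i , eq
    where
    f : ℕ → A
    f = fold x ρ

    next : ∀ {i} → i ≤ d → f (suc i) ∈ applyUpTo f (suc d)
    next i≤d with m≤n⇒m<n∨m≡n i≤d
    ... | inj₁ i<d  = ∈-applyUpTo⁺ f (s≤s i<d)
    ... | inj₂ refl = here period

    distinct : ∀ {i j} → i < j → j < suc d → f i ≢ f j
    distinct {i} {j} i<j j≤d eq with m≤n⇒∃[o]m+o≡n i<j
    -- Here `j` is `suc i + t`; cancelling `i` iterations leaves `f (suc t) ≡ x` with `t < d`.
    ... | t , refl = min {t} (≤-trans (s≤s (m≤n+m t i)) (s≤s⁻¹ j≤d))
      (fold-injective i (fold-P (suc t) Px) Px
        (sym (≡.trans eq (≡.trans (cong f (sym (+-suc i t))) (fold-+ x ρ i)))))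

  -- Rotate the cycle to start at `x` and merge it with the orbit of `y`: `E`-related elements have
  -- the same `R`-predecessors. The two are disjoint, since stability would carry any common element
  -- back to `y`.
  insert : ∀ {xs x y} → StableCycle xs → x ∈ xs → E x y → P y → y ∉ xs →
           ∃[ ys ] (StableCycle ys × xs ⊆ ys × y ∈ ys)
  insert {x = x} {y} c x∈ Exy Py y∉ with ∈-∃++ x∈ | orbit Py
  ... | as , bs , refl | ys , o , from = (x ∷ bs ++ as) ++ (y ∷ ys) , record
    { unique = Unique.++⁺ (↭ₛ.Unique-resp-↭ (≡.setoid A) (↭⇒↭ₛ perm) (unique c)) (unique o) λ where
        (z∈ , z∈o) → let i , eq = from z∈o in
          y∉ (stable-fold⁻¹ c i Py (subst (_∈ as ++ x ∷ bs) eq (∈-resp-↭ (↭-sym perm) z∈)))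
    ; sound  = λ z∈ → [ sound c ∘ ∈-resp-↭ (↭-sym perm) , sound o ]′ (∈-++⁻ xs′ z∈)
    ; stable = λ z∈ → [ ∈-++⁺ˡ ∘ ∈-resp-↭ perm ∘ stable c ∘ ∈-resp-↭ (↭-sym perm)
                      , ∈-++⁺ʳ xs′ ∘ stable o ]′ (∈-++⁻ xs′ z∈)
    ; cyclic = cyclic-merge (λ Rzx → R-resp-E Rzx Exy) (λ Rzy → R-resp-E Rzy (E-sym Exy))
                 (cyclic-rotate as (cyclic c)) (cyclic o)
    } , ∈-++⁺ˡ ∘ ∈-resp-↭ perm , ∈-++⁺ʳ xs′ (here refl)
    where
    xs′ = x ∷ bs ++ as
    perm : as ++ x ∷ bs ↭ xs′
    perm = ↭.++-comm as (x ∷ bs)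

  -- A `ρ`-step, in either direction, stays inside a stable cycle, so a step that leaves it must be
  -- an `E`-move.
  exit : ∀ {xs x y} → StableCycle xs → x ∈ xs → y ∉ xs → SymClosure Step x y → E x y × P y
  exit c x∈ y∉ (fwd (step _ Py (inj₁ Exy)))  = Exy , Py
  exit c x∈ y∉ (bwd (step Py _ (inj₁ Eyx)))  = E-sym Eyx , Py
  exit c x∈ y∉ (fwd (step _ _ (inj₂ refl)))  = contradiction (stable c x∈) y∉
  exit c x∈ y∉ (bwd (step Py _ (inj₂ refl))) = contradiction (stable⁻¹ c Py x∈) y∉

  -- Follow the path and, whenever it leaves the current cycle, insert the orbit of the new element.
  extend : ∀ {xs x y} → StableCycle xs → x ∈ xs → EqClosure Step x y →
           ∃[ ys ] (StableCycle ys × xs ⊆ ys × y ∈ ys)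
  extend c x∈ ε = _ , c , id , x∈
  extend {xs} c x∈ (_◅_ {j = y} s ss) with y ∈? xs
  ... | yes y∈ = extend c y∈ ss
  ... | no  y∉ with exit c x∈ y∉ s
  ...   | Exy , Py with insert c x∈ Exy Py y∉
  ...     | ys , c′ , xs⊆ys , y∈ with extend c′ y∈ ss
  ...       | zs , c″ , ys⊆zs , z∈ = zs , c″ , ys⊆zs ∘ xs⊆ys , z∈

  covering : (∀ {x y} → P x → P y → EqClosure Step x y) →
             ∀ xs → (∀ {x} → x ∈ xs → P x) → ∃[ ys ] (StableCycle ys × xs ⊆ ys)
  covering conn []       sound-xs = [] , record
    { unique = []
    ; sound  = λ ()
    ; stable = λ ()
    ; cyclic = tt
    } , id
  covering conn (x ∷ xs) sound-xs with covering conn xs (sound-xs ∘ there)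
  -- An empty cycle offers no place to splice, so the orbit of `x` itself starts the cycle.
  ... | [] , c , xs⊆[] with orbit (sound-xs (here refl))
  ...   | ys , o , _ = x ∷ ys , o , λ where
          (here refl) → here refl
          (there z∈)  → contradiction (xs⊆[] z∈) λ ()
  covering conn (x ∷ xs) sound-xs | y ∷ ys , c , xs⊆ys
    with extend c (here refl) (conn (sound c (here refl)) (sound-xs (here refl)))
  ... | zs , c′ , ys⊆zs , x∈ = zs , c′ , λ where
          (here refl) → x∈
          (there z∈)  → ys⊆zs (xs⊆ys z∈)

-- Prefixes, rotations and permutations of lists.

take-length-++ : ∀ (xs : List A) {ys n} → length xs ≡ n → take n (xs ++ ys) ≡ xs
take-length-++ []       refl = refl
take-length-++ (x ∷ xs) refl = cong (x ∷_) (take-length-++ xs refl)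

take-++-≤ : ∀ {n} (xs : List A) {ys zs} → n ≤ length xs → take n (xs ++ ys) ≡ take n (xs ++ zs)
take-++-≤ {n = zero}  xs       n≤ = refl
take-++-≤ {n = suc n} (x ∷ xs) n≤ = cong (x ∷_) (take-++-≤ xs (s≤s⁻¹ n≤))

rot : List A → List A
rot []       = []
rot (x ∷ xs) = xs ∷ʳ x

rot-↭ : (xs : List A) → rot xs ↭ xs
rot-↭ []       = ↭-refl
rot-↭ (x ∷ xs) = ↭.++-comm xs [ x ]

fold-rot-↭ : ∀ (xs : List A) i → fold xs rot i ↭ xs
fold-rot-↭ xs zero    = ↭-refl
fold-rot-↭ xs (suc i) = ↭-trans (rot-↭ _) (fold-rot-↭ xs i)

fold-rot-++ : ∀ (xs ys : List A) → fold (xs ++ ys) rot (length xs) ≡ ys ++ xs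
fold-rot-++ []       ys = sym (++-identityʳ ys)
fold-rot-++ (x ∷ xs) ys = begin
  rot (fold (x ∷ xs ++ ys) rot (length xs))  ≡⟨ fold-suc (x ∷ xs ++ ys) rot (length xs) ⟨
  fold ((xs ++ ys) ++ [ x ]) rot (length xs)
    ≡⟨ cong (λ zs → fold zs rot (length xs)) (++-assoc xs ys [ x ]) ⟩
  fold (xs ++ ys ++ [ x ]) rot (length xs)   ≡⟨ fold-rot-++ xs (ys ++ [ x ]) ⟩
  (ys ++ [ x ]) ++ xs                        ≡⟨ ++-assoc ys [ x ] xs ⟩
  ys ++ x ∷ xs                               ∎
  where open ≡-Reasoning

fold-rot-length : ∀ (xs : List A) j → fold xs rot (j * length xs) ≡ xs
fold-rot-length xs zero    = refl
fold-rot-length xs (suc j) = begin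
  fold xs rot (length xs + j * length xs)              ≡⟨ fold-+ xs rot (length xs) ⟩
  fold (fold xs rot (j * length xs)) rot (length xs)   ≡⟨ cong rotate (fold-rot-length xs j) ⟩
  fold xs rot (length xs)                              ≡⟨ cong rotate (++-identityʳ xs) ⟨
  fold (xs ++ []) rot (length xs)                      ≡⟨ fold-rot-++ xs [] ⟩
  xs                                                   ∎
  where
  open ≡-Reasoning
  rotate : List _ → List _
  rotate zs = fold zs rot (length xs)

-- Pull the letters of `xs` to the front one by one. Those still to come differ from the one
-- removed, so they survive its removal.
extract : ∀ {xs ys : List A} → Unique xs → All (_∈ ys) xs → ∃[ zs ] ys ↭ xs ++ zs
extract {ys = ys} [] [] = ys , ↭-refl
extract {xs = x ∷ xs} (x∉xs ∷ u) (x∈ys ∷ xs∈ys) with ∈-∃++ x∈ys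
... | as , bs , refl with extract u (All.zipWith others (x∉xs , xs∈ys))
  where
  others : ∀ {y} → x ≢ y × y ∈ as ++ x ∷ bs → y ∈ as ++ bs
  others (x≢y , y∈) with ∈-resp-↭ (↭.shift x as bs) y∈
  ... | here refl = contradiction refl x≢y
  ... | there y∈′ = y∈′
...   | zs , p = zs , ↭-trans (↭.shift x as bs) (prep x p)

-- A finite search space, and the passage between vectors and lists.

boundedLists : ℕ → ℕ → List (List ℕ)
boundedLists h zero    = [] ∷ []
boundedLists h (suc l) = cartesianProductWith _∷_ (upTo (suc h)) (boundedLists h l)

∈-boundedLists : ∀ {h w} → All (_≤ h) w → w ∈ boundedLists h (length w)
∈-boundedLists []          = here refl
∈-boundedLists (x≤h ∷ w≤h) = ∈-cartesianProductWith⁺ _∷_ (∈-upTo⁺ (s≤s x≤h)) (∈-boundedLists w≤h)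

sum-toList : ∀ {n} (w : Vec ℕ n) → sum (toList w) ≡ weight w
sum-toList []      = refl
sum-toList (x ∷ w) = cong (x +_) (sum-toList w)

height-lub : ∀ {n b} (w : Vec ℕ n) → (∀ {x} → x ∈ᵛ w → x ≤ b) → height w ≤ b
height-lub []      w≤b = z≤n
height-lub (x ∷ w) w≤b = ⊔-lub (w≤b (here refl)) (height-lub w (w≤b ∘ there))

∈⇒≤height : ∀ {n x} {w : Vec ℕ n} → x ∈ᵛ w → x ≤ height w
∈⇒≤height {w = y ∷ w} (here refl) = m≤m⊔n y (height w)
∈⇒≤height {w = y ∷ w} (there x∈)  = ≤-trans (∈⇒≤height x∈) (m≤n⊔m y (height w))

height-unique : ∀ {n h} (w : Vec ℕ n) → (∀ x → (x ∈ᵛ w) ⇔ (x ≤ h)) → height w ≡ h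
height-unique {h = h} w letters = ≤-antisym
  (height-lub w (λ {x} → Equivalence.to (letters x)))
  (∈⇒≤height (Equivalence.from (letters h) ≤-refl))

toVecs : ∀ {n} {ws : List (List A)} → All (λ w → length w ≡ n) ws →
         ∃[ vs ] map (toList {n = n}) vs ≡ ws
toVecs []                    = [] , refl
toVecs {ws = w ∷ _} (refl ∷ p) with toVecs p
... | vs , eq = fromList w ∷ vs , cong₂ _∷_ (toList∘fromList w) eq

toList-injective′ : ∀ {n} {v w : Vec A n} → toList v ≡ toList w → v ≡ w
toList-injective′ {v = v} {w} eq =
  ≡.trans (sym (cast-is-id refl v)) (toList-injective refl v w eq)

-- Overlaps and common prefixes.

-- Overlap s v w is OverlapList s (toList v) (toList w) definitionally.
OverlapList : ℕ → Rel (List A) _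
OverlapList s u v = ∃[ p ] ∃[ m ] ∃[ q ] (length m ≡ s × u ≡ p ++ m × v ≡ m ++ q)

SamePrefix : ℕ → Rel (List A) _
SamePrefix s u v = take s u ≡ take s v

-- An overlap depends on its target only through the first `s` letters, which are `m`; the remainder
-- of `w` serves as the new `q`.
Overlap-resp-SamePrefix : ∀ s {u v w : List A} →
  OverlapList s u v → SamePrefix s v w → OverlapList s u w
Overlap-resp-SamePrefix s {w = w} (p , m , q , ∣m∣≡s , u≡ , refl) eq =
  p , m , drop s w , ∣m∣≡s , u≡ , (begin
    w                    ≡⟨ take++drop≡id s w ⟨
    take s w ++ drop s w ≡⟨ cong (_++ drop s w) eq ⟨
    take s (m ++ q) ++ drop s w ≡⟨ cong (_++ drop s w) (take-length-++ m ∣m∣≡s) ⟩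
    m ++ drop s w        ∎)
  where open ≡-Reasoning

-- The words as lists, and the rotation `ρ`.

module Words (s t h k : ℕ) (s≤t : s ≤ t) (coprime : gcd s (2 + t) ≡ 1) where

  n : ℕ
  n = 2 + t

  -- The list form of `𝒲 k n h`: `bounded` and `full` together fix the set of letters. Each field is
  -- a decidable condition, so the words can be found by filtering.
  record Word (w : List ℕ) : Set where
    constructor word
    field
      len     : length w ≡ n
      total   : sum w ≡ k
      bounded : All (_≤ h) w
      full    : All (_∈ w) (upTo (suc h))

  open Word

  open DecMembership ℕ._≟_ using (_∈?_)

  word? : Decidable Word
  word? w = map′ (λ (a , b , c , d) → word a b c d) (λ (word a b c d) → a , b , c , d)
    (length w ℕ.≟ n ×-dec sum w ℕ.≟ k ×-dec All.all? (_≤? h) w ×-dec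
     All.all? (_∈? w) (upTo (suc h)))

  Word-resp-↭ : ∀ {u v} → u ↭ v → Word u → Word v
  Word-resp-↭ u↭v (word l w b f) = word
    (≡.trans (sym (↭.↭-length u↭v)) l)
    (≡.trans (sym (sum-↭ u↭v)) w)
    (↭.All-resp-↭ u↭v b)
    (All.map (∈-resp-↭ u↭v) f)

  ρ : List ℕ → List ℕ
  ρ w = fold w rot (n ∸ s)

  s≤n : s ≤ n
  s≤n = ≤-trans s≤t (m≤n+m t 2)

  fold-ρ : ∀ w i → fold w ρ i ≡ fold w rot (i * (n ∸ s))
  fold-ρ w zero    = refl
  fold-ρ w (suc i) = ≡.trans (cong ρ (fold-ρ w i)) (sym (fold-+ w rot (n ∸ s)))

  fold-rot-period : ∀ {w} → Word w → ∀ j → fold w rot (j * n) ≡ w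
  fold-rot-period {w} Ww j =
    ≡.trans (cong (λ l → fold w rot (j * l)) (sym (len Ww))) (fold-rot-length w j)

  ρ-Word : ∀ {w} → Word w → Word (ρ w)
  ρ-Word {w} = Word-resp-↭ (↭-sym (fold-rot-↭ w (n ∸ s)))

  -- Rotating `n` times by `n ∸ s` letters amounts to `n ∸ s` full turns.
  ρ-period : ∀ {w} → Word w → fold w ρ n ≡ w
  ρ-period {w} Ww = ≡.trans (fold-ρ w n)
    (≡.trans (cong (fold w rot) (*-comm n (n ∸ s))) (fold-rot-period Ww (n ∸ s)))

  ρ-Overlap : ∀ {w} → Word w → OverlapList s w (ρ w)
  ρ-Overlap {w} Ww = p , m , p , ∣m∣≡s , sym w≡ , (begin
    fold w rot (n ∸ s)          ≡⟨ cong (λ z → fold z rot (n ∸ s)) w≡ ⟨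
    fold (p ++ m) rot (n ∸ s)   ≡⟨ cong (fold (p ++ m) rot) ∣p∣≡ ⟨
    fold (p ++ m) rot (length p) ≡⟨ fold-rot-++ p m ⟩
    m ++ p                      ∎)
    where
    open ≡-Reasoning
    p = take (n ∸ s) w
    m = drop (n ∸ s) w
    w≡ : p ++ m ≡ w
    w≡ = take++drop≡id (n ∸ s) w
    ∣p∣≡ : length p ≡ n ∸ s
    ∣p∣≡ = ≡.trans (length-take (n ∸ s) w)
      (m≤n⇒m⊓n≡m (≤-trans (m∸n≤m n s) (≤-reflexive (sym (len Ww)))))
    ∣m∣≡s : length m ≡ s
    ∣m∣≡s = ≡.trans (length-drop (n ∸ s) w)
      (≡.trans (cong (_∸ (n ∸ s)) (len Ww)) (m∸[m∸n]≡n s≤n))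

  open CycleGrowth (≡-dec ℕ._≟_) (OverlapList s) (SamePrefix s) Word sym
    (Overlap-resp-SamePrefix s) ρ (suc t) ρ-Word ρ-Overlap ρ-period public

  -- Connecting words by rotations, adjacent changes and permutations.

  infix 4 _~_
  _~_ : Rel (List ℕ) _
  _~_ = EqClosure Step

  ~-sym : ∀ {u v} → u ~ v → v ~ u
  ~-sym = EqClosure.symmetric Step

  ρ-~ : ∀ {w} → Word w → ∀ i → w ~ fold w ρ i
  ρ-~ Ww zero    = ε
  ρ-~ Ww (suc i) = ρ-~ Ww i ◅◅
    EqClosure.return (step (fold-P i Ww) (fold-P (suc i) Ww) (inj₂ refl))

  i[n∸s]+is≡in : ∀ i → i * (n ∸ s) + i * s ≡ i * n
  i[n∸s]+is≡in i = ≡.trans (sym (*-distribˡ-+ i (n ∸ s) s)) (cong (i *_) (m∸n+n≡m s≤n))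

  -- Modulo full turns `ρ` is rotation by `-s`, and `s` is invertible modulo `n`. A Bézout identity
  -- with natural coefficients has two forms, hence two cases.
  rot-~ : ∀ {w} → Word w → w ~ rot w
  rot-~ {w} Ww with Bézout.identity (subst (GCD.GCD s n) coprime (gcd-GCD s n))
  -- From `1 + x * s = y * n`: after `y` full turns, `x` applications of `ρ` make `x` full turns and
  -- one letter more.
  ... | Bézout.-+ x y eq = subst (w ~_) (begin
    fold w ρ x                               ≡⟨ fold-ρ w x ⟩
    fold w rot (x * (n ∸ s))
      ≡⟨ cong (λ z → fold z rot (x * (n ∸ s))) (fold-rot-period Ww y) ⟨
    fold (fold w rot (y * n)) rot (x * (n ∸ s)) ≡⟨ fold-+ w rot (x * (n ∸ s)) ⟨
    fold w rot (x * (n ∸ s) + y * n)         ≡⟨ cong (λ z → fold w rot (x * (n ∸ s) + z)) eq ⟨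
    fold w rot (x * (n ∸ s) + suc (x * s))   ≡⟨ cong (fold w rot) (+-suc (x * (n ∸ s)) (x * s)) ⟩
    rot (fold w rot (x * (n ∸ s) + x * s))   ≡⟨ cong (rot ∘ fold w rot) (i[n∸s]+is≡in x) ⟩
    rot (fold w rot (x * n))                 ≡⟨ cong rot (fold-rot-period Ww x) ⟩
    rot w                                    ∎) (ρ-~ Ww x)
    where open ≡-Reasoning
  -- From `1 + y * n = x * s`: now `x` applications of `ρ` to `rot w` complete `x` full turns of
  -- `w`, so the path runs backwards.
  ... | Bézout.+- x y eq = ~-sym (subst (rot w ~_) (begin
    fold (rot w) ρ x                         ≡⟨ fold-ρ (rot w) x ⟩
    fold (rot w) rot (x * (n ∸ s))
      ≡⟨ cong (λ z → fold (rot z) rot (x * (n ∸ s))) (fold-rot-period Ww y) ⟨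
    fold (fold w rot (suc (y * n))) rot (x * (n ∸ s)) ≡⟨ fold-+ w rot (x * (n ∸ s)) ⟨
    fold w rot (x * (n ∸ s) + suc (y * n))   ≡⟨ cong (λ z → fold w rot (x * (n ∸ s) + z)) eq ⟩
    fold w rot (x * (n ∸ s) + x * s)         ≡⟨ cong (fold w rot) (i[n∸s]+is≡in x) ⟩
    fold w rot (x * n)                       ≡⟨ fold-rot-period Ww x ⟩
    w                                        ∎)
    (ρ-~ (Word-resp-↭ (↭-sym (rot-↭ w)) Ww) x))
    where open ≡-Reasoning

  fold-rot-~ : ∀ {w} → Word w → ∀ i → w ~ fold w rot i
  fold-rot-~ Ww zero    = ε
  fold-rot-~ {w} Ww (suc i) = fold-rot-~ Ww i ◅◅
    rot-~ (Word-resp-↭ (↭-sym (fold-rot-↭ w i)) Ww)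

  ++-comm-~ : ∀ u v → Word (u ++ v) → u ++ v ~ v ++ u
  ++-comm-~ u v W = subst (u ++ v ~_) (fold-rot-++ u v) (fold-rot-~ W (length u))

  -- The common part `u` has length `n - 2`, which is at least `s`, so the two words share their
  -- first `s` letters.
  replace-suffix : ∀ u {a b c d} → Word (u ++ a ∷ b ∷ []) → Word (u ++ c ∷ d ∷ []) →
                   u ++ a ∷ b ∷ [] ~ u ++ c ∷ d ∷ []
  replace-suffix u W W′ = EqClosure.return (step W W′ (inj₁ (take-++-≤ u s≤∣u∣)))
    where
    s≤∣u∣ : s ≤ length u
    s≤∣u∣ = ≤-trans s≤t (≤-reflexive (+-cancelˡ-≡ 2 t (length u) (begin
      2 + t            ≡⟨ len W ⟨
      length (u ++ _)  ≡⟨ length-++ u ⟩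
      length u + 2     ≡⟨ +-comm (length u) 2 ⟩
      2 + length u     ∎)))
      where open ≡-Reasoning

  -- Rotate the pair to the end of the word, change it there, and rotate back.
  replace-pair : ∀ u {a b c d} v → Word (u ++ a ∷ b ∷ v) → Word (u ++ c ∷ d ∷ v) →
                 u ++ a ∷ b ∷ v ~ u ++ c ∷ d ∷ v
  replace-pair u {a} {b} {c} {d} v W W′ =
    to a b W ◅◅ replace-suffix (v ++ u) (Word′ a b W) (Word′ c d W′) ◅◅ ~-sym (to c d W′)
    where
    shift-pair : ∀ x y → v ++ u ++ x ∷ y ∷ [] ≡ (v ++ u) ++ x ∷ y ∷ []
    shift-pair x y = sym (++-assoc v u _)

    Word′ : ∀ x y → Word (u ++ x ∷ y ∷ v) → Word ((v ++ u) ++ x ∷ y ∷ [])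
    Word′ x y = Word-resp-↭ (↭-trans (↭-reflexive (sym (++-assoc u (x ∷ y ∷ []) v)))
      (↭-trans (↭.++-comm (u ++ x ∷ y ∷ []) v) (↭-reflexive (shift-pair x y))))

    to : ∀ x y → Word (u ++ x ∷ y ∷ v) → u ++ x ∷ y ∷ v ~ (v ++ u) ++ x ∷ y ∷ []
    to x y Wxy = subst₂ _~_ (++-assoc u _ v) (shift-pair x y)
      (++-comm-~ (u ++ x ∷ y ∷ []) v (subst Word (sym (++-assoc u _ v)) Wxy))

  -- A transposition of neighbours is a change of an adjacent pair. The prefix `u` collects the
  -- letters already passed, since each move needs the whole word.
  ↭-~ : ∀ u {v w} → v ↭ w → Word (u ++ v) → u ++ v ~ u ++ w
  ↭-~ u refl W = ε
  ↭-~ u {x ∷ v} {x ∷ w} (prep x p) W = subst₂ _~_ (++-assoc u [ x ] v) (++-assoc u [ x ] w)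
    (↭-~ (u ∷ʳ x) p (subst Word (sym (++-assoc u [ x ] v)) W))
  ↭-~ u {x ∷ y ∷ v} {y ∷ x ∷ w} (swap x y p) W =
    replace-pair u v W W′ ◅◅
    subst₂ _~_ (++-assoc u (y ∷ x ∷ []) v) (++-assoc u (y ∷ x ∷ []) w)
      (↭-~ (u ++ y ∷ x ∷ []) p (subst Word (sym (++-assoc u (y ∷ x ∷ []) v)) W′))
    where
    W′ : Word (u ++ y ∷ x ∷ v)
    W′ = Word-resp-↭ (↭.++⁺ˡ u (swap x y ↭-refl)) W
  ↭-~ u (trans p q) W = ↭-~ u p W ◅◅ ↭-~ u q (Word-resp-↭ (↭.++⁺ˡ u p) W)

  -- Unit transfers behind a fixed copy of all letters.

  Core : List ℕ → Set
  Core c = All (_∈ c) (upTo (suc h))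

  Core-∷ʳ : ∀ {c} → Core c → ∀ a → Core (c ∷ʳ a)
  Core-∷ʳ core a = All.map ∈-++⁺ˡ core

  same-length : ∀ c {u v} → Word (c ++ u) → Word (c ++ v) → length u ≡ length v
  same-length c {u} {v} W W′ = +-cancelˡ-≡ (length c) _ _ (begin
    length c + length u ≡⟨ length-++ c ⟨
    length (c ++ u)     ≡⟨ len W ⟩
    n                   ≡⟨ len W′ ⟨
    length (c ++ v)     ≡⟨ length-++ c ⟩
    length c + length v ∎)
    where open ≡-Reasoning

  same-sum : ∀ c {u v} → Word (c ++ u) → Word (c ++ v) → sum u ≡ sum v
  same-sum c {u} {v} W W′ = +-cancelˡ-≡ (sum c) _ _ (begin
    sum c + sum u ≡⟨ sum-++ c u ⟨
    sum (c ++ u)  ≡⟨ total W ⟩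
    k             ≡⟨ total W′ ⟨
    sum (c ++ v)  ≡⟨ sum-++ c v ⟩
    sum c + sum v ∎)
    where open ≡-Reasoning

  -- As `c` already supplies every letter, changing the tail cannot destroy `full`; only length, sum
  -- and bound have to be kept.
  Core-Word : ∀ {c u v} → Core c → Word (c ++ u) → length v ≡ length u → sum v ≡ sum u →
              All (_≤ h) v → Word (c ++ v)
  Core-Word {c} {u} {v} core W ∣v∣ Σv b = record
    { len     = ≡.trans (length-++ c) (≡.trans (cong (length c +_) ∣v∣)
                  (≡.trans (sym (length-++ c)) (len W)))
    ; total   = ≡.trans (sum-++ c v) (≡.trans (cong (sum c +_) Σv)
                  (≡.trans (sym (sum-++ c u)) (total W)))
    ; bounded = All.++⁺ (All.++⁻ˡ c (bounded W)) b
    ; full    = All.map ∈-++⁺ˡ core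
    }

  positive-entry : ∀ u → 1 ≤ sum u → ∃[ e ] ∃[ v ] u ↭ suc e ∷ v
  positive-entry (zero ∷ u)  1≤Σ with positive-entry u 1≤Σ
  ... | e , v , p = e , zero ∷ v , ↭-trans (prep zero p) (swap zero (suc e) ↭-refl)
  positive-entry (suc e ∷ u) 1≤Σ = e , u , ↭-refl

  -- Each round permutes a positive letter next to `a` and moves one unit from it to `a`. The tail
  -- sum drops by one per round, so `d ≤ sum u` guarantees enough units.
  raise : ∀ d {c a b} u → Core c → Word (c ++ a ∷ u) → a + d ≡ b → b ≤ h → d ≤ sum u →
          ∃[ v ] (Word (c ++ b ∷ v) × c ++ a ∷ u ~ c ++ b ∷ v)
  raise zero {a = a} u core W refl b≤h d≤ rewrite +-identityʳ a = u , W , ε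
  raise (suc d) {c} {a} u core W refl b≤h d≤ with positive-entry u (≤-trans (s≤s z≤n) d≤)
  ... | e , v , p =
    let a∷p = prep a p
        W₁ = Word-resp-↭ (↭.++⁺ˡ c a∷p) W
        a<h = ≤-trans (m<m+n a (s≤s z≤n)) b≤h
        -- The transfer turns `a , suc e` into `suc a , e`; the bound `a < h` holds because `a` is
        -- still below `b`.
        W₂ = Core-Word core W₁ refl (sym (+-suc a (e + sum v)))
               (case All.++⁻ʳ c (bounded W₁) of λ where (_ ∷ e<h ∷ bs) → a<h ∷ <⇒≤ e<h ∷ bs)
        x , W₃ , eq = raise d (e ∷ v) core W₂ (sym (+-suc a d)) b≤h
               (s≤s⁻¹ (≤-trans d≤ (≤-reflexive (sum-↭ p))))
    in x , W₃ , ↭-~ c a∷p W ◅◅ replace-pair c v W₁ W₂ ◅◅ eq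

  -- Compare the first letters of the two tails, raise the smaller to the larger, and absorb the now
  -- common letter into the core. The recursion is on the length `l`, because `raise` returns a tail
  -- that is not a subterm.
  Core-~ : ∀ l c u v → length u ≡ l → Core c → Word (c ++ u) → Word (c ++ v) → c ++ u ~ c ++ v
  Core-~-< : ∀ l c {a b} u v → length u ≡ l → a < b → Core c →
             Word (c ++ a ∷ u) → Word (c ++ b ∷ v) → c ++ a ∷ u ~ c ++ b ∷ v
  Core-~-∷ : ∀ l c a u v → length u ≡ l → Core c →
             Word (c ++ a ∷ u) → Word (c ++ a ∷ v) → c ++ a ∷ u ~ c ++ a ∷ v

  Core-~ zero    c []      []      _  core W W′ = ε
  Core-~ zero    c []      (b ∷ v) _  core W W′ with () ← same-length c W W′
  Core-~ (suc l) c (a ∷ u) []      _  core W W′ with () ← same-length c W W′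
  Core-~ (suc l) c (a ∷ u) (b ∷ v) eq core W W′ with <-cmp a b
  ... | tri< a<b _ _  = Core-~-< l c u v (suc-injective eq) a<b core W W′
  ... | tri≈ _ refl _ = Core-~-∷ l c a u v (suc-injective eq) core W W′
  ... | tri> _ _ b<a  = ~-sym (Core-~-< l c v u
    (suc-injective (≡.trans (same-length c W′ W) eq)) b<a core W′ W)

  Core-~-< l c {a} {b} u v eq a<b core W W′ =
    -- Enough units are available: `a + sum u` equals `b + sum v`, which is at least `b`.
    let x , W₁ , a~b = raise (b ∸ a) u core W (m+[n∸m]≡n (<⇒≤ a<b))
                         (All.head (All.++⁻ʳ c (bounded W′)))
                         (m≤n+o⇒m∸n≤o b a (≤-trans (m≤m+n b (sum v))
                           (≤-reflexive (same-sum c W′ W))))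
    in a~b ◅◅ Core-~-∷ l c b x v (≡.trans (suc-injective (same-length c W₁ W)) eq) core W₁ W′

  Core-~-∷ l c a u v eq core W W′ = subst₂ _~_ (++-assoc c [ a ] u) (++-assoc c [ a ] v)
    (Core-~ l (c ∷ʳ a) u v eq (Core-∷ʳ core a)
      (subst Word (sym (++-assoc c [ a ] u)) W) (subst Word (sym (++-assoc c [ a ] v)) W′))

  -- Permute both words so that `0, …, h` stands in front; this common core then allows the tails to
  -- be matched.
  connected : ∀ {u v} → Word u → Word v → u ~ v
  connected {u} {v} Wu Wv =
    let x , p = extract (Unique.upTo⁺ (suc h)) (full Wu)
        y , q = extract (Unique.upTo⁺ (suc h)) (full Wv)
    in ↭-~ [] p Wu
       ◅◅ Core-~ _ (upTo (suc h)) x y refl (All.tabulate id) (Word-resp-↭ p Wu) (Word-resp-↭ q Wv)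
       ◅◅ ~-sym (↭-~ [] q Wv)

  stableCycle : ∃[ ws ] (StableCycle ws × (∀ {w} → Word w → w ∈ ws))
  stableCycle =
    let ws , c , ⊆ws = covering connected (filter word? (boundedLists h n))
                         (proj₂ ∘ ∈-filter⁻ word? {xs = boundedLists h n})
    in ws , c , λ {w} W → ⊆ws (∈-filter⁺ word?
         (subst (λ l → w ∈ boundedLists h l) (len W) (∈-boundedLists (bounded W))) W)

-- Transfer to vectors, and the theorem.

Word⇔𝒲 : ∀ s t h k s≤t g → h < 2 + t → (w : Vec ℕ (2 + t)) →
         Words.Word s t h k s≤t g (toList w) ⇔ 𝒲 k (2 + t) h w
Word⇔𝒲 s t h k s≤t g h<n w = mk⇔
  (λ (word _ total bounded full) →
    let letters = λ x → mk⇔ (All.lookup bounded ∘ ∈-toList⁺)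
                             (λ x≤h → ∈-toList⁻ (All.lookup full (∈-upTo⁺ (s≤s x≤h))))
    in (h , h<n , letters) , height-unique w letters , ≡.trans (sym (sum-toList w)) total)
  (λ ((h′ , _ , letters) , height≡h , weight≡k) →
    -- The bound `h′` inside `IsWeakOrder` is existential; it is the maximum letter and hence equals
    -- `h`.
    let h′≡h = ≡.trans (sym (height-unique w letters)) height≡h
        letters′ = subst (λ h → ∀ x → (x ∈ᵛ w) ⇔ (x ≤ h)) h′≡h letters
    in word (length-toList w) (≡.trans (sum-toList w) weight≡k)
         (All.tabulate (λ {x} → Equivalence.to (letters′ x) ∘ ∈-toList⁻))
         (All.tabulate (λ {x} x∈ → ∈-toList⁺ (Equivalence.from (letters′ x) (s≤s⁻¹ (∈-upTo⁻ x∈))))))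
  where open Words s t h k s≤t g

cyclic-map⁻ : ∀ {R : Rel A r} {f : B → A} xs → CyclicallyLinked R (map f xs) →
              CyclicallyLinked (R on f) xs
cyclic-map⁻ []       _ = tt
cyclic-map⁻ {R = R} {f = f} (x ∷ xs) l =
  Linked.map⁻ (subst (Linked R) (sym (map-++ f (x ∷ xs) [ x ])) l)

theorem4p4 : ∀ (n s h k : ℕ) → 1 ≤ n → 1 ≤ s → s ≤ n ∸ 2 →
    1 ≤ k → k ≤ n C 2 → 0 ≤ h → h < n → gcd s n ≡ 1 →
    ∃[ ws ] IsOverlapCycle s (𝒲 k n h) ws
-- For `n < 2` the truncated `n ∸ 2` is `0`, contradicting `1 ≤ s`.
theorem4p4 0             s h k _ 1≤s s≤0 = contradiction (≤-trans 1≤s s≤0) λ ()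
theorem4p4 1             s h k _ 1≤s s≤0 = contradiction (≤-trans 1≤s s≤0) λ ()
theorem4p4 (suc (suc t)) s h k _ _ s≤t _ _ _ h<n g
  with ws , c , complete ← Words.stableCycle s t h k s≤t g
  -- All entries have length `n`, so the cycle of lists is the image of a list of vectors; `toList`
  -- reflects uniqueness and links.
  with vs , refl ← toVecs (All.tabulate (Words.Word.len ∘ Words.StableCycle.sound c))
  = vs , record
  { unique = Unique.map⁻ (unique c)
  ; lists  = λ w → let open Equivalence (Word⇔𝒲 s t h k s≤t g h<n w) in mk⇔
      (to ∘ sound c ∘ ∈-map⁺ toList)
      (λ w∈𝒲 → let v , v∈ , eq = ∈-map⁻ toList (complete (from w∈𝒲)) in
        subst (_∈ vs) (sym (toList-injective′ eq)) v∈)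
  ; cyclic = cyclic-map⁻ vs (cyclic c)
  }
  where
  open Words s t h k s≤t g
  open StableCycle
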